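{- Let $n>3$ be an integer and let $G=C_{2n}(2,1,n)$ (a $5$-regular circulant graph). Then $G$ is word-representable and $R(G)\leq 3$. Furthermore, for $n=3$, the graph $C_6(2,1,3)$ is word-representable and $R(C_6(2,1,3))=1$.
   Context: Two distinct letters $x,y$ alternate in a word $w$ if, after deleting all other letters from $w$, the resulting word is of the form $xyxy\cdots$ or $yxyx\cdots$ (of even or odd length). A graph $G=(V,E)$ is word-representable if there is a word $w$ over the alphabet $V$, containing every letter of $V$ at least once, such that for all distinct $x,y\in V$, $xy\in E$ if and only if $x$ and $y$ alternate in $w$. A word is $k$-uniform if every letter occurs in it exactly $k$ times; $G$ is $k$-representable if some $k$-uniform word represents it, and the representation number $R(G)$ of a word-representable graph $G$ is the least such $k$. For an integer $m$ and a set $R$ of positive integers each at most $m/2$, the circulant graph $C_m(R)$ has vertex set $\{0,1,\dots,m-1\}$, with $i$ and $j$ adjacent iff $\min(|i-j|,\,m-|i-j|)\in R$. $C_{2n}(2,1,n)$ denotes the circulant graph on $2n$ vertices with jump set $\{1,2,n\}$. -}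

module Defs where

open import Data.Fin.Base using (Fin; toℕ)
open import Data.Fin.Properties using (_≟_)
open import Data.List.Base using (List; []; _∷_; filter; length)
open import Data.List.Membership.Propositional using (_∈_)
open import Data.List.Relation.Unary.All using (All; []; _∷_; lookup)
open import Data.Nat.Base using (ℕ; zero; suc; _*_; _∸_; _≤_; _<_; _⊓_; ∣_-_∣; z≤n; s≤s)
open import Data.Nat.Properties using (≤-trans; <-irrefl; *-monoʳ-≤; ≤-refl; ∣-∣-comm; ∣n-n∣≡0)
open import Data.Product.Base using (_×_; _,_; proj₁; ∃-syntax)
open import Data.Sum.Base using (_⊎_)
open import Function.Bundles using (_⇔_)
open import Relation.Binary.Definitions using (Irreflexive; Symmetric)
open import Relation.Binary.PropositionalEquality.Core using (_≡_; _≢_; refl; subst)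
open import Relation.Nullary.Decidable using (_⊎-dec_)

record Graph (m : ℕ) : Set₁ where
  field
    Adj    : Fin m → Fin m → Set
    sym    : Symmetric Adj
    irrefl : Irreflexive _≡_ Adj

open Graph public using (Adj)

Word : ℕ → Set
Word m = List (Fin m)

restrict : ∀ {m} → Fin m → Fin m → Word m → Word m
restrict x y = filter (λ z → (z ≟ x) ⊎-dec (z ≟ y))

-- The word  x y x y ⋯  of length ℓ.
alternating : ∀ {m} → Fin m → Fin m → (ℓ : ℕ) → Word m
alternating x y zero    = []
alternating x y (suc ℓ) = x ∷ alternating y x ℓ

Alternate : ∀ {m} → Fin m → Fin m → Word m → Set
Alternate x y w =
  ∃[ ℓ ] (restrict x y w ≡ alternating x y ℓ ⊎ restrict x y w ≡ alternating y x ℓ)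

Represents : ∀ {m} → Word m → Graph m → Set
Represents w G =
  (∀ v → v ∈ w) × (∀ x y → x ≢ y → Adj G x y ⇔ Alternate x y w)

WordRepresentable : ∀ {m} → Graph m → Set
WordRepresentable G = ∃[ w ] Represents w G

Uniform : ∀ {m} → ℕ → Word m → Set
Uniform k w = ∀ v → length (filter (v ≟_) w) ≡ k

Representable : ∀ {m} → ℕ → Graph m → Set
Representable k G = ∃[ w ] (Uniform k w × Represents w G)

-- R(G) is rendered as a relation, because a minimum is not a total function
-- of G; it determines at most one k.
IsRepresentationNumber : ∀ {m} → Graph m → ℕ → Set
IsRepresentationNumber G k =
  Representable k G × (∀ j → Representable j G → k ≤ j)

-- "R(G) ≤ b" asserts in particular that R(G) exists.
RepresentationNumber≤ : ∀ {m} → Graph m → ℕ → Set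
RepresentationNumber≤ G b = ∃[ k ] (IsRepresentationNumber G k × k ≤ b)

circularDistance : ∀ {m} → Fin m → Fin m → ℕ
circularDistance {m} i j = ∣ toℕ i - toℕ j ∣ ⊓ (m ∸ ∣ toℕ i - toℕ j ∣)

-- The list R stands for the set of its entries; 2 * r ≤ m says r ≤ m/2.
circulant : (m : ℕ) (R : List ℕ) → All (λ r → 0 < r × 2 * r ≤ m) R → Graph m
circulant m R valid = record
  { Adj    = λ i j → circularDistance i j ∈ R
  ; sym    = λ {i} {j} →
      subst (λ d → d ⊓ (m ∸ d) ∈ R) (∣-∣-comm (toℕ i) (toℕ j))
  ; irrefl = λ { {i} refl i∼i → <-irrefl refl (proj₁ (lookup valid
      (subst (λ d → d ⊓ (m ∸ d) ∈ R) (∣n-n∣≡0 (toℕ i)) i∼i))) }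
  }

-- C₂ₙ(2,1,n); the bound 3 ≤ n makes the three jumps distinct.
C₂ₙ[2,1,n] : (n : ℕ) → 3 ≤ n → Graph (2 * n)
C₂ₙ[2,1,n] n 3≤n = circulant (2 * n) (2 ∷ 1 ∷ n ∷ [])
  ( (s≤s z≤n , *-monoʳ-≤ 2 (≤-trans (s≤s (s≤s z≤n)) 3≤n))
  ∷ (s≤s z≤n , *-monoʳ-≤ 2 (≤-trans (s≤s z≤n) 3≤n))
  ∷ (≤-trans (s≤s z≤n) 3≤n , ≤-refl)
  ∷ [] )

{-# OPTIONS --safe #-}

-- Place the letter i of ℤ/2n at the times i, i − n − 2 and i − 3 modulo 2n,
-- with ties at time t broken as t, t + n + 2, t + 3.  The resulting 3-uniform
-- cyclic word is invariant under i ↦ i + 1, and alternation in a uniform word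
-- is invariant under rotation of the word, so whether x and y alternate
-- depends only on their distance d.  Cutting the circle just before the time
-- x − 3 gives the restriction to x and y explicitly: xyxyxy for d ∈ {1, 2, n},
-- xxyyxy for 3 ≤ d ≤ n − 2, and yxxyxy for d = n − 1.
--
-- That a least k exists is constructive: a k-uniform word over m letters has
-- length at most m k, so k-representability is decided by a finite search.
module Submission where

open import Defs
open import Data.Fin.Base as Fin using (Fin; toℕ)
open import Data.Fin.Properties using (_≟_; any?; all?; toℕ-injective; toℕ-fromℕ<; toℕ<n)
open import Data.List.Base
  using (List; []; _∷_; _++_; _∷ʳ_; [_]; length; filter; concat; applyUpTo; upTo; drop; allFin)
open import Data.List.Membership.DecPropositional using (_∈?_)
open import Data.List.Membership.Propositional using (_∈_)
open import Data.List.Membership.Propositional.Properties using (∈-allFin; ∈-applyUpTo⁺)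
open import Data.List.Properties
open import Data.List.Relation.Binary.Permutation.Propositional using (↭-sym)
open import Data.List.Relation.Binary.Permutation.Propositional.Properties
  using (↭-length; filter-↭; ∷↭∷ʳ)
open import Data.List.Relation.Binary.Pointwise using (Pointwise-≡⇒≡)
open import Data.List.Relation.Binary.Sublist.Propositional using (_⊆_; _∷_; minimum)
open import Data.List.Relation.Binary.Sublist.Propositional.Properties
  using (filter⁺; filter-⊆; length-mono-≤; ++⁺; ++⁺ˡ; to-≋)
open import Data.List.Relation.Unary.All as All using (All; []; _∷_)
open import Data.List.Relation.Unary.All.Properties as All using (all-filter)
open import Data.List.Relation.Unary.AllPairs using (_∷_)
open import Data.List.Relation.Unary.Any using (here; there)
open import Data.List.Relation.Unary.Unique.Propositional using (Unique)
open import Data.List.Relation.Unary.Unique.Propositional.Properties using (applyUpTo⁺₁)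
open import Data.Nat.Base
open import Data.Nat.DivMod using (_mod_; m%n<n; m<n⇒m%n≡m; [m+n]%n≡m%n)
open import Data.Nat.Properties as ℕₚ hiding (_≟_)
open import Data.Nat.Tactic.RingSolver using (solve-∀)
open import Data.Product.Base using (_×_; _,_; proj₁; proj₂; ∃-syntax; map₂)
open import Data.Sum.Base as Sum using (_⊎_; inj₁; inj₂; [_,_]′)
open import Function.Base using (_∘_; id)
open import Function.Bundles using (_⇔_; mk⇔; module Equivalence)
open import Function.Construct.Composition using (_⇔-∘_)
open import Function.Construct.Symmetry using (⇔-sym)
open import Relation.Binary.Definitions using (tri<; tri≈; tri>)
open import Relation.Binary.PropositionalEquality
  using (_≡_; _≢_; _≗_; refl; sym; trans; cong; cong₂; subst)
open import Relation.Nullary.Decidable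
open import Relation.Nullary.Negation using (¬_; contradiction)
open import Relation.Unary using (Decidable)

private variable
  A : Set
  m n k : ℕ

-- Counting occurrences; the length of a uniform word

count : Fin m → Word m → ℕ
count v w = length (filter (v ≟_) w)

count-++ : ∀ (v : Fin m) u w → count v (u ++ w) ≡ count v u + count v w
count-++ v u w = trans (cong length (filter-++ (v ≟_) u w)) (length-++ (filter (v ≟_) u))

length-restrict : ∀ {x y : Fin m} → x ≢ y → ∀ w → length (restrict x y w) ≡ count x w + count y w
length-restrict x≢y [] = refl
length-restrict {x = x} {y} x≢y (z ∷ w) with ih ← length-restrict x≢y w | x ≟ z | y ≟ z
... | yes refl | yes refl = contradiction refl x≢y
... | yes refl | no _ = trans (cong length (filter-accept _ {xs = w} (inj₁ refl))) (cong suc ih)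
... | no x≢z | yes refl = trans (cong length (filter-accept _ {xs = w} (inj₂ refl))) (trans (cong suc ih) (sym (+-suc _ _)))
... | no x≢z | no y≢z = trans (cong length (filter-reject _ {xs = w} [ x≢z ∘ sym , y≢z ∘ sym ]′)) ih

count-unique : ∀ {v : Fin m} {w} → Unique w → v ∈ w → count v w ≡ 1
count-unique {v = v} (v∉w ∷ _) (here refl) =
  trans (cong length (filter-accept (v ≟_) refl)) (cong (suc ∘ length) (filter-none (v ≟_) v∉w))
count-unique {v = v} (x∉w ∷ w!) (there v∈w) =
  trans (cong length (filter-reject (v ≟_) (All.lookup x∉w v∈w ∘ sym))) (count-unique w! v∈w)

length≡filter+filter¬ : ∀ {P : A → Set} (P? : Decidable P) xs →
  length xs ≡ length (filter P? xs) + length (filter (¬? ∘ P?) xs)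
length≡filter+filter¬ P? [] = refl
length≡filter+filter¬ P? (x ∷ xs) with ih ← length≡filter+filter¬ P? xs | P? x
... | yes _ = cong suc ih
... | no _ = trans (cong suc ih) (sym (+-suc _ _))

-- Induction on the alphabet `vs`: deleting every copy of `v` costs at most `k` letters and leaves a
-- word over the remaining letters, whose counts cannot have grown because it is a sublist of `w`.
length-≤-counts : ∀ (vs : List (Fin m)) {w} → All (_∈ vs) w → (∀ v → count v w ≤ k) →
  length w ≤ length vs * k
length-≤-counts []       []         _   = z≤n
length-≤-counts []       (() ∷ _)
length-≤-counts (v ∷ vs) {w} w⊆v∷vs count≤k = ≤-trans
  (≤-reflexive (length≡filter+filter¬ (v ≟_) w))
  (+-mono-≤ (count≤k v) (length-≤-counts vs
    (All.zipWith (λ { (v≢z , here z≡v) → contradiction (sym z≡v) v≢z ; (_ , there z∈vs) → z∈vs })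
      (all-filter (¬? ∘ (v ≟_)) w , All.filter⁺ _ w⊆v∷vs))
    (λ u → ≤-trans (length-mono-≤ (filter⁺ (u ≟_) (u ≟_) (λ { refl → id }) (filter-⊆ (¬? ∘ (v ≟_)) w)))
                   (count≤k u))))

Uniform⇒length≤ : ∀ {w : Word m} → Uniform k w → length w ≤ m * k
Uniform⇒length≤ {m = m} {k} {w} uniform = subst (λ l → length w ≤ l * k) (length-tabulate {n = m} id)
  (length-≤-counts (allFin m) (All.universal ∈-allFin w) (≤-reflexive ∘ uniform))

-- Deciding alternation and k-representability

∃word≤? : ∀ N {P : Word m → Set} → (∀ w → Dec (P w)) → Dec (∃[ w ] (length w ≤ N × P w))
∃word≤? zero P? = map′ (λ p → [] , z≤n , p) (λ { ([] , _ , p) → p }) (P? [])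
∃word≤? (suc N) P? = map′
  (λ { (inj₁ p) → [] , z≤n , p ; (inj₂ (x , w , w≤N , p)) → x ∷ w , s≤s w≤N , p })
  (λ { ([] , _ , p) → inj₁ p ; (x ∷ w , s≤s w≤N , p) → inj₂ (x , w , w≤N , p) })
  (P? [] ⊎-dec any? (λ x → ∃word≤? N (P? ∘ (x ∷_))))

length-alternating : ∀ (x y : Fin m) l → length (alternating x y l) ≡ l
length-alternating x y zero    = refl
length-alternating x y (suc l) = cong suc (length-alternating y x l)

AlternateIn : ℕ → Fin m → Fin m → Word m → Set
AlternateIn l x y w = restrict x y w ≡ alternating x y l ⊎ restrict x y w ≡ alternating y x l

-- The unknown length in `Alternate` can only be that of the restriction. Fixing it leaves two list
-- equalities, which are decidable and, at even length, stable under rotation.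
Alternate⇔AlternateIn : ∀ {x y : Fin m} w {l} → length (restrict x y w) ≡ l →
  Alternate x y w ⇔ AlternateIn l x y w
Alternate⇔AlternateIn {x = x} {y} w refl = mk⇔ to (_ ,_)
  where
  len : ∀ {l r} → restrict x y w ≡ r → length r ≡ l → l ≡ length (restrict x y w)
  len refl e = sym e
  to : Alternate x y w → AlternateIn (length (restrict x y w)) x y w
  to (l , inj₁ e) = subst (λ l → AlternateIn l x y w) (len e (length-alternating x y l)) (inj₁ e)
  to (l , inj₂ e) = subst (λ l → AlternateIn l x y w) (len e (length-alternating y x l)) (inj₂ e)

alternate? : ∀ (x y : Fin m) w → Dec (Alternate x y w)
alternate? x y w = map′ (Equivalence.from alt⇔) (Equivalence.to alt⇔)
  (≡-dec _≟_ _ _ ⊎-dec ≡-dec _≟_ _ _)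
  where alt⇔ = Alternate⇔AlternateIn {x = x} {y} w refl

represents? : ∀ (G : Graph m) → (∀ x y → Dec (Adj G x y)) → ∀ w → Dec (Represents w G)
represents? G adj? w =
  all? (λ v → _∈?_ _≟_ v w)
  ×-dec all? (λ x → all? (λ y → ¬? (x ≟ y) →-dec
    map′ (λ (f , g) → mk⇔ f g) (λ e → Equivalence.to e , Equivalence.from e)
      ((adj? x y →-dec alternate? x y w) ×-dec (alternate? x y w →-dec adj? x y))))

representable? : ∀ (G : Graph m) → (∀ x y → Dec (Adj G x y)) → ∀ k → Dec (Representable k G)
representable? {m} G adj? k = map′ (map₂ proj₂) (map₂ (λ {w} p → Uniform⇒length≤ {w = w} (proj₁ p) , p))
  (∃word≤? (m * k) (λ w → all? (λ v → count v w ℕₚ.≟ k) ×-dec represents? G adj? w))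

least : ∀ {P : ℕ → Set} → Decidable P → ∀ b → P b → ∃[ k ] ((P k × (∀ j → P j → k ≤ j)) × k ≤ b)
least P? b pb with P? 0
... | yes p0 = 0 , (p0 , λ _ _ → z≤n) , z≤n
least P? zero pb | no ¬p0 = contradiction pb ¬p0
least P? (suc b) pb | no ¬p0 with least (P? ∘ suc) b pb
... | k , (pk , k≤) , k≤b = suc k , (pk , λ { zero p0 → contradiction p0 ¬p0 ; (suc j) pj → s≤s (k≤ j pj) }) , s≤s k≤b

circularDistance∈? : ∀ R (x y : Fin m) → Dec (circularDistance x y ∈ R)
circularDistance∈? R x y = _∈?_ ℕₚ._≟_ (circularDistance x y) R

-- Restrictions, and alternation under swapping and rotation

Uniform⇒∈ : ∀ {w : Word m} → Uniform (suc k) w → ∀ v → v ∈ w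
Uniform⇒∈ {w = w} uniform v with _∈?_ _≟_ v w
... | yes v∈w = v∈w
... | no v∉w = contradiction (trans (sym (uniform v)) (cong length (filter-none (v ≟_) (All.¬Any⇒All¬ w v∉w)))) 1+n≢0

-- A sublist of full length is the whole list. Hence a restriction of known length is found by
-- exhibiting a long enough subsequence in `x` and `y`, without evaluating the filter.
restrict-≡ : ∀ {x y : Fin m} {us w} → us ⊆ w → All (λ z → z ≡ x ⊎ z ≡ y) us →
  length (restrict x y w) ≡ length us → restrict x y w ≡ us
restrict-≡ {x = x} {y} {us} {w} us⊆w us⊆xy len =
  sym (Pointwise-≡⇒≡ (to-≋ (sym len)
    (subst (_⊆ restrict x y w) (filter-all _ us⊆xy) (filter⁺ xy? xy? (λ { refl → id }) us⊆w))))
  where xy? = λ z → (z ≟ x) ⊎-dec (z ≟ y)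

Alternate-sym : ∀ {x y : Fin m} {w} → Alternate x y w → Alternate y x w
Alternate-sym {x = x} {y} {w} (l , alt) =
  l , Sum.swap (Sum.map (trans swapped) (trans swapped) alt)
  where
  swapped : restrict y x w ≡ restrict x y w
  swapped = filter-≐ _ _ (Sum.swap , Sum.swap) w

alternating-∷ʳ : ∀ (x y : Fin m) k → alternating x y (k * 2) ∷ʳ x ≡ alternating x y (suc (k * 2))
alternating-∷ʳ x y zero    = refl
alternating-∷ʳ x y (suc k) = cong (λ w → x ∷ y ∷ w) (alternating-∷ʳ x y k)

-- Even length is essential: the last letter then differs from the first, so the moved letter
-- continues the pattern. Writing the length as `k * 2` lets it unfold two letters at a time.
alternating-rotate : ∀ {x y z : Fin m} k {w} → z ∷ w ≡ alternating x y (k * 2) →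
  w ∷ʳ z ≡ alternating y x (k * 2)
alternating-rotate (suc k) refl = cong (_ ∷_) (alternating-∷ʳ _ _ k)

-- The letters of `u` are moved to the end one by one; each move exchanges the roles of `x` and `y`,
-- whence the `Sum.swap`.
alternating-++-comm : ∀ {x y : Fin m} k u w → u ++ w ≡ alternating x y (k * 2) →
  w ++ u ≡ alternating x y (k * 2) ⊎ w ++ u ≡ alternating y x (k * 2)
alternating-++-comm k []      w eq = inj₁ (trans (++-identityʳ w) eq)
alternating-++-comm k (z ∷ u) w eq = subst (λ v → v ≡ _ ⊎ v ≡ _) (++-assoc w [ z ] u)
  (Sum.swap (alternating-++-comm k u (w ∷ʳ z)
    (trans (sym (++-assoc u w [ z ])) (alternating-rotate k eq))))

AlternateIn-++-comm : ∀ {x y : Fin m} k u w →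
  AlternateIn (k * 2) x y (u ++ w) → AlternateIn (k * 2) x y (w ++ u)
AlternateIn-++-comm {x = x} {y} k u w = subst (λ v → v ≡ _ ⊎ v ≡ _) (sym (filter-++ _ w u)) ∘
  [ alternating-++-comm k (restrict x y u) (restrict x y w) ∘ trans (sym (filter-++ _ u w))
  , Sum.swap ∘ alternating-++-comm k (restrict x y u) (restrict x y w) ∘ trans (sym (filter-++ _ u w)) ]′

-- Locating subsequences in a concatenation of blocks

applyUpTo-cong : ∀ {f g : ℕ → A} → f ≗ g → ∀ e → applyUpTo f e ≡ applyUpTo g e
applyUpTo-cong {f = f} {g} f≗g e = trans (sym (map-upTo f e)) (trans (map-cong f≗g (upTo e)) (map-upTo g e))

drop-applyUpTo : ∀ (g : ℕ → A) {i e} → i < e → drop i (applyUpTo g e) ≡ g i ∷ drop (suc i) (applyUpTo g e)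
drop-applyUpTo g {zero}  {suc e} _         = refl
drop-applyUpTo g {suc i} {suc e} (s≤s i<e) = drop-applyUpTo (g ∘ suc) i<e

module Placement (g : ℕ → List A) (e : ℕ) where

  private
    from : ℕ → List A
    from i = concat (drop i (applyUpTo g e))

    from-step : ∀ {i us} → i < e → us ⊆ g i ++ from (suc i) → us ⊆ from i
    from-step {us = us} i<e = subst (λ l → us ⊆ concat l) (sym (drop-applyUpTo g i<e))

    -- `_≤‴_` raises its left bound at each step, matching the removal of blocks from the front.
    skip : ∀ {i j us} → i ≤‴ j → j < e → us ⊆ from j → us ⊆ from i
    skip ≤‴-refl          j<e us⊆ = us⊆
    skip (≤‴-step 1+i≤j) j<e us⊆ =
      from-step (≤-<-trans (<⇒≤ (≤‴⇒≤ 1+i≤j)) j<e) (++⁺ˡ _ (skip 1+i≤j j<e us⊆))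

  -- Reads a subsequence from left to right: `i` is the earliest block still available, `j` the
  -- block that supplies `as`, and `us` is found strictly later.
  place : ∀ {i j as us} → i ≤ j → j < e → as ⊆ g j → us ⊆ concat (drop (suc j) (applyUpTo g e)) →
    as ++ us ⊆ concat (drop i (applyUpTo g e))
  place i≤j j<e as⊆ us⊆ = skip (≤⇒≤‴ i≤j) j<e (from-step j<e (++⁺ as⊆ us⊆))

  -- For two letters whose blocks coincide for some parameters only; in that event the order inside
  -- the block decides, through `ab⊆`.
  place₂ : ∀ {h i j a b us} → h ≤ i → i ≤ j → j < e → [ a ] ⊆ g i → [ b ] ⊆ g j →
    (i ≡ j → a ∷ b ∷ [] ⊆ g j) → us ⊆ concat (drop (suc j) (applyUpTo g e)) →
    a ∷ b ∷ us ⊆ concat (drop h (applyUpTo g e))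
  place₂ h≤i i≤j j<e a⊆ b⊆ ab⊆ us⊆ with m≤n⇒m<n∨m≡n i≤j
  ... | inj₁ i<j  = place h≤i (<-trans i<j j<e) a⊆ (place i<j j<e b⊆ us⊆)
  ... | inj₂ refl = place h≤i j<e (ab⊆ refl) us⊆

-- The 3-uniform cyclic word and its rotations

module _ (n : ℕ) .{{_ : NonZero n}} where

  private instance
    2n≢0 : NonZero (2 * n)
    2n≢0 = m*n≢0 2 n

  letter : ℕ → Fin (2 * n)
  letter t = t mod (2 * n)

  toℕ-letter : ∀ t → toℕ (letter t) ≡ t % (2 * n)
  toℕ-letter t = toℕ-fromℕ< (m%n<n t (2 * n))

  letter-toℕ : ∀ v → letter (toℕ v) ≡ v
  letter-toℕ v = toℕ-injective (trans (toℕ-letter (toℕ v)) (m<n⇒m%n≡m (toℕ<n v)))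

  letter-+2n : ∀ t → letter (t + 2 * n) ≡ letter t
  letter-+2n t = toℕ-injective (trans (toℕ-letter (t + 2 * n))
    (trans ([m+n]%n≡m%n t (2 * n)) (sym (toℕ-letter t))))

  block : ℕ → Word (2 * n)
  block t = letter t ∷ letter (n + 2 + t) ∷ letter (3 + t) ∷ []

  block-+2n : ∀ t → block (t + 2 * n) ≡ block t
  block-+2n t = cong₂ (λ a bc → a ∷ bc) (letter-+2n t) (cong₂ (λ b c → b ∷ c ∷ [])
    (trans (cong letter (sym (+-assoc (n + 2) t (2 * n)))) (letter-+2n (n + 2 + t)))
    (letter-+2n (3 + t)))

  -- One full turn of the cyclic word, cut just before time `s`.
  word : ℕ → Word (2 * n)
  word s = concat (applyUpTo (λ t → block (s + t)) (2 * n))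

  -- A window as long as the period, moved by one, loses its first entry and regains the same entry
  -- at its end.
  shift-window : ∀ (g : ℕ → A) → (∀ t → g (t + 2 * n) ≡ g t) → ∀ s →
    ∃[ x ] ∃[ xs ] (applyUpTo (λ t → g (s + t)) (2 * n) ≡ x ∷ xs
                  × applyUpTo (λ t → g (suc s + t)) (2 * n) ≡ xs ∷ʳ x)
  shift-window g periodic s = go (2 * n) periodic
    where
    -- The length is generalised from `2 * n` to a nonzero `e` so that it can be matched as a
    -- successor.
    go : ∀ e .{{_ : NonZero e}} → (∀ t → g (t + e) ≡ g t) →
      ∃[ x ] ∃[ xs ] (applyUpTo (λ t → g (s + t)) e ≡ x ∷ xs
                    × applyUpTo (λ t → g (suc s + t)) e ≡ xs ∷ʳ x)
    go (suc e) periodic = g (s + 0) , applyUpTo (λ t → g (s + suc t)) e , refl ,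
      trans (applyUpTo-cong (λ t → cong g (sym (+-suc s t))) (suc e))
      (trans (sym (applyUpTo-∷ʳ (λ t → g (s + suc t)) e))
        (cong (applyUpTo (λ t → g (s + suc t)) e ∷ʳ_)
          (trans (periodic s) (cong g (sym (+-identityʳ s))))))

  count-window : ∀ s v → count v (applyUpTo (λ t → letter (s + t)) (2 * n)) ≡ 1
  count-window zero v = count-unique
    (applyUpTo⁺₁ letter (2 * n) (λ {i} {j} i<j j<2n eq → <⇒≢ i<j
      (trans (sym (m<n⇒m%n≡m (<-trans i<j j<2n)))
      (trans (sym (toℕ-letter i)) (trans (cong toℕ eq)
      (trans (toℕ-letter j) (m<n⇒m%n≡m j<2n)))))))
    (subst (_∈ applyUpTo letter (2 * n)) (letter-toℕ v) (∈-applyUpTo⁺ letter (toℕ<n v)))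
  count-window (suc s) v with shift-window letter letter-+2n s
  ... | x , xs , eq , eq′ = trans (cong (count v) eq′)
    (trans (↭-length (filter-↭ (v ≟_) (↭-sym (∷↭∷ʳ x xs))))
    (trans (cong (count v) (sym eq)) (count-window s v)))

  count-interleave : ∀ v (a b c : ℕ → Fin (2 * n)) e →
    count v (concat (applyUpTo (λ t → a t ∷ b t ∷ c t ∷ []) e))
    ≡ count v (applyUpTo a e) + (count v (applyUpTo b e) + count v (applyUpTo c e))
  count-interleave v a b c zero    = refl
  count-interleave v a b c (suc e)
    rewrite count-++ v [ a 0 ] (b 0 ∷ c 0 ∷ concat (applyUpTo (λ t → a (suc t) ∷ b (suc t) ∷ c (suc t) ∷ []) e))
          | count-++ v [ b 0 ] (c 0 ∷ concat (applyUpTo (λ t → a (suc t) ∷ b (suc t) ∷ c (suc t) ∷ []) e))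
          | count-++ v [ c 0 ] (concat (applyUpTo (λ t → a (suc t) ∷ b (suc t) ∷ c (suc t) ∷ []) e))
          | count-++ v [ a 0 ] (applyUpTo (a ∘ suc) e)
          | count-++ v [ b 0 ] (applyUpTo (b ∘ suc) e)
          | count-++ v [ c 0 ] (applyUpTo (c ∘ suc) e)
          | count-interleave v (a ∘ suc) (b ∘ suc) (c ∘ suc) e
    = rearrange (count v [ a 0 ]) (count v [ b 0 ]) (count v [ c 0 ]) _ _ _
    where
    rearrange : ∀ p q r x y z → p + (q + (r + (x + (y + z)))) ≡ p + x + (q + y + (r + z))
    rearrange = solve-∀

  -- Each of the three columns of the blocks runs through 2n consecutive letters modulo 2n and so
  -- contributes every letter once.
  word-uniform : ∀ s → Uniform 3 (word s)
  word-uniform s v = trans (count-interleave v _ _ _ (2 * n)) (cong₂ _+_ (count-window s v) (cong₂ _+_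
    (trans (cong (count v) (applyUpTo-cong (λ t → cong letter (sym (+-assoc (n + 2) s t))) (2 * n)))
      (count-window (n + 2 + s) v))
    (count-window (3 + s) v)))

  length-restrict-word : ∀ s {x y} → x ≢ y → length (restrict x y (word s)) ≡ 6
  length-restrict-word s {x} {y} x≢y = trans (length-restrict x≢y (word s))
    (cong₂ _+_ (word-uniform s x) (word-uniform s y))

  word-suc : ∀ s → ∃[ u ] ∃[ w ] (word s ≡ u ++ w × word (suc s) ≡ w ++ u)
  word-suc s with shift-window block block-+2n s
  ... | u , us , eq , eq′ = u , concat us , cong concat eq ,
    trans (cong concat eq′) (trans (sym (concat-++ us [ u ])) (cong (concat us ++_) (++-identityʳ u)))

  AlternateIn-word : ∀ k {x y} s → AlternateIn (k * 2) x y (word 0) ⇔ AlternateIn (k * 2) x y (word s)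
  AlternateIn-word k zero = mk⇔ id id
  AlternateIn-word k {x} {y} (suc s) with word-suc s
  ... | u , w , eq , eq′ = step ⇔-∘ AlternateIn-word k s
    where
    step : AlternateIn (k * 2) x y (word s) ⇔ AlternateIn (k * 2) x y (word (suc s))
    step rewrite eq | eq′ = mk⇔ (AlternateIn-++-comm k u w) (AlternateIn-++-comm k w u)

  -- By uniformity the restriction has length 6 = `3 * 2` at every cut, so the rotation argument for
  -- even lengths applies.
  Alternate-word : ∀ s {x y} → x ≢ y → Alternate x y (word 0) ⇔ Alternate x y (word s)
  Alternate-word s {x} {y} x≢y = ⇔-sym (Alternate⇔AlternateIn (word s) (length-restrict-word s x≢y))
    ⇔-∘ (AlternateIn-word 3 s ⇔-∘ Alternate⇔AlternateIn (word 0) (length-restrict-word 0 x≢y))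

-- Restrictions to two letters, by distance, for n > 3

module _ {n : ℕ} (3<n : 3 < n) where

  private
    instance
      n≢0 : NonZero n
      n≢0 = >-nonZero (≤-trans (s≤s z≤n) 3<n)

    jumps : List ℕ
    jumps = 2 ∷ 1 ∷ n ∷ []

    n+[1+i]≤2n : ∀ {i} → i < n → suc (n + i) ≤ 2 * n
    n+[1+i]≤2n {i} i<n = ≤-trans (≤-reflexive (sym (+-suc n i)))
      (+-monoʳ-≤ n (≤-trans i<n (≤-reflexive (sym (+-identityʳ n)))))

    i+n<2n : ∀ {i} → i < n → i + n < 2 * n
    i+n<2n {i} i<n = subst (_< 2 * n) (+-comm n i) (n+[1+i]≤2n i<n)

    -- This is where `3 < n` makes the offsets up to n + 3 fit into a single turn.
    ≤3+n⇒<2n : ∀ {i} → i ≤ 3 + n → i < 2 * n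
    ≤3+n⇒<2n i≤3+n = ≤-<-trans i≤3+n (i+n<2n 3<n)

  module _ (s : ℕ) where

    private
      open Placement (λ t → block n (s + t)) (2 * n) using (place; place₂)

      -- With the cut at time `s`, the letter x with x - 3 = `s` is `Y 0`, and `Y d` is x + d.
      Y : ℕ → Fin (2 * n)
      Y d = letter n (3 + (s + d))

      Y≡first : ∀ d → Y d ≡ letter n (s + (3 + d))
      Y≡first d = cong (letter n) (eq s d)
        where
        eq : ∀ s d → 3 + (s + d) ≡ s + (3 + d)
        eq = solve-∀

      -- The offset of this occurrence is d + 1 - n modulo 2n. Here it is raised by 2n; `Y≡second′`
      -- treats `suc d` ≥ n, where it is already a natural number.
      Y≡second : ∀ d → Y d ≡ letter n (n + 2 + (s + (suc d + n)))
      Y≡second d = trans (sym (letter-+2n n (3 + (s + d)))) (cong (letter n) (eq n s d))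
        where
        eq : ∀ n s d → 3 + (s + d) + 2 * n ≡ n + 2 + (s + (suc d + n))
        eq = solve-∀

      Y≡second′ : ∀ {d} i → suc d ≡ i + n → Y d ≡ letter n (n + 2 + (s + i))
      Y≡second′ {d} i 1+d≡i+n = cong (letter n) (trans (eq₁ s d) (trans (cong (λ j → s + j + 2) 1+d≡i+n) (eq₂ n s i)))
        where
        eq₁ : ∀ s d → 3 + (s + d) ≡ s + suc d + 2
        eq₁ = solve-∀
        eq₂ : ∀ n s i → s + (i + n) + 2 ≡ n + 2 + (s + i)
        eq₂ = solve-∀

      -- The names `first`, `second`, `third` refer to positions inside a block, not to order in
      -- time. After the cut, `Y 0` occurs at the offsets 0 (`third`), 3 (`first`) and n + 1
      -- (`second`).
      first : ∀ d → [ Y d ] ⊆ block n (s + (3 + d))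
      first d = Y≡first d ∷ minimum _

      second : ∀ d → [ Y d ] ⊆ block n (s + (suc d + n))
      second d = ++⁺ˡ [ _ ] (Y≡second d ∷ minimum _)

      second′ : ∀ {d} i → suc d ≡ i + n → [ Y d ] ⊆ block n (s + i)
      second′ i 1+d≡i+n = ++⁺ˡ [ _ ] (Y≡second′ i 1+d≡i+n ∷ minimum _)

      third : ∀ d → [ Y d ] ⊆ block n (s + d)
      third d = ++⁺ˡ (_ ∷ _ ∷ []) (refl ∷ minimum _)

      distance-n-1⊆word : ∀ {d} → n ≡ suc d → Y d ∷ Y 0 ∷ Y 0 ∷ Y d ∷ Y 0 ∷ Y d ∷ [] ⊆ word n s
      distance-n-1⊆word {d} refl =
        -- The second-position occurrence of `Y d` has wrapped to offset 0, where it precedes `Y 0`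
        -- in third position.
        place z≤n (≤3+n⇒<2n z≤n) (++⁺ˡ [ _ ] (Y≡second′ 0 refl ∷ refl ∷ minimum _))
        (place₂ (s≤s z≤n) (s≤s⁻¹ 3<n) (≤3+n⇒<2n (m≤n+m d 4)) (first 0) (third d)
          -- The offsets 3 and d coincide when n = 4; first position precedes third.
          (λ { refl → Y≡first 0 ∷ ++⁺ˡ [ _ ] (refl ∷ minimum _) })
        (place (n≤1+n _) (≤3+n⇒<2n (m≤n+m _ 2)) (second 0)
        (place ≤-refl (≤3+n⇒<2n (m≤n+m _ 1)) (first d)
        (minimum _))))

      distance-1⊆word : Y 0 ∷ Y 1 ∷ Y 0 ∷ Y 1 ∷ Y 0 ∷ Y 1 ∷ [] ⊆ word n s
      distance-1⊆word =
        place z≤n (≤3+n⇒<2n z≤n) (third 0)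
        (place ≤-refl (≤3+n⇒<2n (s≤s z≤n)) (third 1)
        (place (s≤s (s≤s z≤n)) (≤3+n⇒<2n (m≤m+n 3 n)) (first 0)
        (place ≤-refl (≤3+n⇒<2n (≤-trans 3<n (m≤n+m n 3))) (first 1)
        (place (s≤s 3<n) (≤3+n⇒<2n (m≤n+m _ 2)) (second 0)
        (place ≤-refl (≤3+n⇒<2n (m≤n+m _ 1)) (second 1)
        (minimum _))))))

      distance-2⊆word : Y 0 ∷ Y 2 ∷ Y 0 ∷ Y 2 ∷ Y 0 ∷ Y 2 ∷ [] ⊆ word n s
      distance-2⊆word =
        place z≤n (≤3+n⇒<2n z≤n) (third 0)
        (place (s≤s z≤n) (≤3+n⇒<2n (s≤s (s≤s z≤n))) (third 2)
        (place ≤-refl (≤3+n⇒<2n (m≤m+n 3 n)) (first 0)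
        -- The offsets 5 and n + 1 coincide when n = 4; first position precedes second.
        (place₂ (n≤1+n 4) (s≤s 3<n) (≤3+n⇒<2n (m≤n+m _ 2)) (first 2) (second 0)
          (λ 5≡1+n → trans (Y≡first 2) (cong (λ i → letter n (s + i)) 5≡1+n) ∷ Y≡second 0 ∷ minimum _)
        (place (n≤1+n _) (≤3+n⇒<2n ≤-refl) (second 2)
        (minimum _)))))

      distance-n⊆word : Y 0 ∷ Y n ∷ Y 0 ∷ Y n ∷ Y 0 ∷ Y n ∷ [] ⊆ word n s
      distance-n⊆word =
        place z≤n (≤3+n⇒<2n z≤n) (third 0)
        (place ≤-refl (≤3+n⇒<2n (s≤s z≤n)) (second′ 1 refl)
        (place (s≤s (s≤s z≤n)) (≤3+n⇒<2n (m≤m+n 3 n)) (first 0)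
        (place 3<n (≤3+n⇒<2n (m≤n+m n 3)) (third n)
        (place ≤-refl (≤3+n⇒<2n (m≤n+m _ 2)) (second 0)
        (place (n≤1+n _) (≤3+n⇒<2n ≤-refl) (first n)
        (minimum _))))))

      distance-d⊆word : ∀ {d} → 3 ≤ d → suc d < n → Y 0 ∷ Y 0 ∷ Y d ∷ Y d ∷ Y 0 ∷ Y d ∷ [] ⊆ word n s
      distance-d⊆word {d} 3≤d 1+d<n =
        place z≤n (≤3+n⇒<2n z≤n) (third 0)
        -- The occurrences fall at 0, 3, d, d + 3, n + 1, d + 1 + n, with ties exactly at d = 3 and
        -- at d = n - 2.
        (place₂ (s≤s z≤n) 3≤d (<-trans d<n n<2n) (first 0) (third d)
          (λ { refl → Y≡first 0 ∷ ++⁺ˡ [ _ ] (refl ∷ minimum _) })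
        (place₂ (m≤n+m (suc d) 2) (s≤s 1+d<n) (≤3+n⇒<2n (m≤n+m _ 2)) (first d) (second 0)
          (λ 3+d≡1+n → trans (Y≡first d) (cong (λ i → letter n (s + i)) 3+d≡1+n) ∷ Y≡second 0 ∷ minimum _)
        (place (s≤s (+-monoˡ-≤ n (≤-trans (s≤s z≤n) 3≤d))) (i+n<2n 1+d<n) (second d)
        (minimum _))))
        where
        d<n = <-trans (n<1+n d) 1+d<n
        n<2n = ≤3+n⇒<2n (m≤n+m n 3)

    Alternate⇔jump : ∀ {d} → 0 < d → d ≤ n → Y 0 ≢ Y d → Alternate (Y 0) (Y d) (word n s) ⇔ d ∈ jumps
    Alternate⇔jump {d} 0<d d≤n Y0≢Yd = cases d 0<d d≤n Y0≢Yd
      where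
      restrict-word : ∀ {d us} → Y 0 ≢ Y d → us ⊆ word n s → All (λ z → z ≡ Y 0 ⊎ z ≡ Y d) us →
        length us ≡ 6 → restrict (Y 0) (Y d) (word n s) ≡ us
      restrict-word Y0≢Yd us⊆ us⊆xy len =
        restrict-≡ us⊆ us⊆xy (trans (length-restrict-word n s Y0≢Yd) (sym len))

      alternates : ∀ {d} → Y 0 ≢ Y d → d ∈ jumps → Y 0 ∷ Y d ∷ Y 0 ∷ Y d ∷ Y 0 ∷ Y d ∷ [] ⊆ word n s →
        Alternate (Y 0) (Y d) (word n s) ⇔ d ∈ jumps
      alternates {d} Y0≢Yd d∈jumps ⊆word = mk⇔ (λ _ → d∈jumps) (λ _ → 6 , inj₁ (restrict-word {d} Y0≢Yd ⊆word
        (inj₁ refl ∷ inj₂ refl ∷ inj₁ refl ∷ inj₂ refl ∷ inj₁ refl ∷ inj₂ refl ∷ []) refl))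

      d∉jumps : ∀ {d} → 3 ≤ d → d < n → ¬ (d ∈ jumps)
      d∉jumps 3≤d d<n (here refl)                 = <⇒≱ (n<1+n 2) 3≤d
      d∉jumps 3≤d d<n (there (here refl))         = <⇒≱ (s≤s (s≤s z≤n)) 3≤d
      d∉jumps 3≤d d<n (there (there (here refl))) = <-irrefl refl d<n

      xx⋯-¬alternating : ∀ {x y : Fin (2 * n)} {w r} → x ≢ y → r ≡ x ∷ x ∷ w →
        ∀ l → ¬ (r ≡ alternating x y l ⊎ r ≡ alternating y x l)
      xx⋯-¬alternating x≢y refl (suc (suc l)) (inj₁ refl) = x≢y refl
      xx⋯-¬alternating x≢y refl (suc (suc l)) (inj₂ refl) = x≢y refl

      yxx⋯-¬alternating : ∀ {x y : Fin (2 * n)} {w r} → x ≢ y → r ≡ y ∷ x ∷ x ∷ w →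
        ∀ l → ¬ (r ≡ alternating x y l ⊎ r ≡ alternating y x l)
      yxx⋯-¬alternating x≢y refl (suc (suc (suc l))) (inj₁ refl) = x≢y refl
      yxx⋯-¬alternating x≢y refl (suc (suc (suc l))) (inj₂ refl) = x≢y refl

      cases : ∀ d → 0 < d → d ≤ n → Y 0 ≢ Y d → Alternate (Y 0) (Y d) (word n s) ⇔ d ∈ jumps
      cases 1 _ _ Y0≢Yd = alternates Y0≢Yd (there (here refl)) distance-1⊆word
      cases 2 _ _ Y0≢Yd = alternates Y0≢Yd (here refl) distance-2⊆word
      cases d@(suc (suc (suc _))) _ d≤n Y0≢Yd with m≤n⇒m<n∨m≡n d≤n
      ... | inj₂ refl = alternates Y0≢Yd (there (there (here refl))) distance-n⊆word
      ... | inj₁ d<n = mk⇔ (λ (l , alt) → contradiction alt (not-alternating l)) (λ d∈jumps → contradiction d∈jumps (d∉jumps 3≤d d<n))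
        where
        3≤d = s≤s (s≤s (s≤s z≤n))
        not-alternating : ∀ l → ¬ (restrict (Y 0) (Y d) (word n s) ≡ alternating (Y 0) (Y d) l
                                 ⊎ restrict (Y 0) (Y d) (word n s) ≡ alternating (Y d) (Y 0) l)
        -- At d = n - 1 the offset `suc d + n` would be 2n, outside the turn, so one `Y d` moves to
        -- the front and the pattern changes.
        not-alternating with m≤n⇒m<n∨m≡n d<n
        ... | inj₁ 1+d<n = xx⋯-¬alternating Y0≢Yd (restrict-word {d} Y0≢Yd (distance-d⊆word 3≤d 1+d<n)
          (inj₁ refl ∷ inj₁ refl ∷ inj₂ refl ∷ inj₂ refl ∷ inj₁ refl ∷ inj₂ refl ∷ []) refl)
        ... | inj₂ 1+d≡n = yxx⋯-¬alternating Y0≢Yd (restrict-word {d} Y0≢Yd (distance-n-1⊆word (sym 1+d≡n))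
          (inj₂ refl ∷ inj₁ refl ∷ inj₁ refl ∷ inj₂ refl ∷ inj₁ refl ∷ inj₂ refl ∷ []) refl)

  -- From arbitrary pairs of vertices to a start and a distance

  -- The shorter arc gives `d`. It starts at `x` if the difference is at most n; otherwise it starts
  -- at `y` and passes through 0 to `x`, which explains the two alternatives.
  letters-at-distance : ∀ {x y : Fin (2 * n)} → toℕ x < toℕ y →
    ∃[ p ] ∃[ d ] (0 < d × d ≤ n × circularDistance x y ≡ d
                 × (x ≡ letter n p × y ≡ letter n (p + d) ⊎ y ≡ letter n p × x ≡ letter n (p + d)))
  letters-at-distance {x} {y} x<y = by-cases (e ≤? n)
    where
    a = toℕ x
    b = toℕ y
    e = b ∸ a
    a+e≡b : a + e ≡ b
    a+e≡b = m+[n∸m]≡n (<⇒≤ x<y)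
    2n≡n+n : 2 * n ≡ n + n
    2n≡n+n = cong (n +_) (+-identityʳ n)
    e<2n : e < 2 * n
    e<2n = ≤-<-trans (m∸n≤m b a) (toℕ<n y)
    2n∸e≤n : n ≤ e → 2 * n ∸ e ≤ n
    2n∸e≤n n≤e = ≤-trans (∸-monoʳ-≤ (2 * n) n≤e)
      (≤-reflexive (trans (cong (_∸ n) 2n≡n+n) (m+n∸n≡m n n)))
    distance≡ : circularDistance x y ≡ e ⊓ (2 * n ∸ e)
    distance≡ = cong (λ i → i ⊓ (2 * n ∸ i)) (m≤n⇒∣m-n∣≡n∸m (<⇒≤ x<y))

    by-cases : Dec (e ≤ n) → _
    by-cases (yes e≤n) = a , e , m<n⇒0<n∸m x<y , e≤n
      , trans distance≡ (m≤n⇒m⊓n≡m (m+n≤o⇒m≤o∸n e (≤-trans (+-mono-≤ e≤n e≤n) (≤-reflexive (sym 2n≡n+n)))))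
      , inj₁ (sym (letter-toℕ n x) , sym (trans (cong (letter n) a+e≡b) (letter-toℕ n y)))
    by-cases (no e≰n) = b , 2 * n ∸ e , m<n⇒0<n∸m e<2n , 2n∸e≤n n≤e
      , trans distance≡ (m≥n⇒m⊓n≡n (≤-trans (2n∸e≤n n≤e) n≤e))
      , inj₂ (sym (letter-toℕ n y) , sym (trans (cong (letter n) b+[2n∸e]≡a+2n)
          (trans (letter-+2n n a) (letter-toℕ n x))))
      where
      n≤e = <⇒≤ (≰⇒> e≰n)
      b+[2n∸e]≡a+2n : b + (2 * n ∸ e) ≡ a + 2 * n
      b+[2n∸e]≡a+2n = trans (cong (_+ (2 * n ∸ e)) (sym a+e≡b))
        (trans (+-assoc a e _) (cong (a +_) (m+[n∸m]≡n (<⇒≤ e<2n))))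

  Alternate⇔jump-apart : ∀ p {d x y} → 0 < d → d ≤ n → x ≢ y → x ≡ letter n p → y ≡ letter n (p + d) →
    Alternate x y (word n 0) ⇔ d ∈ jumps
  Alternate⇔jump-apart p {d} 0<d d≤n x≢y x≡ y≡ = shifted x≢y (trans x≡ p≡Y0) (trans y≡ p+d≡Yd)
    where
    -- The cut time p - 3, raised by 2n to remain a natural number; then `Y 0` is the letter at `p`.
    s = p + (2 * n ∸ 3)
    3+[s+i]≡p+i+2n : ∀ i → 3 + (s + i) ≡ p + i + 2 * n
    3+[s+i]≡p+i+2n i = trans (rearrange p (2 * n ∸ 3) i)
      (cong (p + i +_) (m+[n∸m]≡n (<⇒≤ (≤3+n⇒<2n (m≤m+n 3 n)))))
      where
      rearrange : ∀ p q i → 3 + (p + q + i) ≡ p + i + (3 + q)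
      rearrange = solve-∀
    p+d≡Yd : letter n (p + d) ≡ letter n (3 + (s + d))
    p+d≡Yd = sym (trans (cong (letter n) (3+[s+i]≡p+i+2n d)) (letter-+2n n (p + d)))
    p≡Y0 : letter n p ≡ letter n (3 + (s + 0))
    p≡Y0 = sym (trans (cong (letter n) (trans (3+[s+i]≡p+i+2n 0) (cong (_+ 2 * n) (+-identityʳ p)))) (letter-+2n n p))
    shifted : ∀ {x y} → x ≢ y → x ≡ letter n (3 + (s + 0)) → y ≡ letter n (3 + (s + d)) →
      Alternate x y (word n 0) ⇔ d ∈ jumps
    shifted x≢y refl refl = Alternate⇔jump s 0<d d≤n x≢y ⇔-∘ Alternate-word n s x≢y

  Adj⇔Alternate-< : ∀ {x y} → toℕ x < toℕ y → circularDistance x y ∈ jumps ⇔ Alternate x y (word n 0)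
  Adj⇔Alternate-< {x} {y} x<y with x≢y ← <⇒≢ x<y ∘ cong toℕ | letters-at-distance x<y
  ... | p , d , 0<d , d≤n , refl , inj₁ (x≡ , y≡) = ⇔-sym (Alternate⇔jump-apart p 0<d d≤n x≢y x≡ y≡)
  ... | p , d , 0<d , d≤n , refl , inj₂ (y≡ , x≡) =
    mk⇔ (Alternate-sym {w = word n 0}) (Alternate-sym {w = word n 0})
    ⇔-∘ ⇔-sym (Alternate⇔jump-apart p 0<d d≤n (x≢y ∘ sym) y≡ x≡)

  word-represents : Represents (word n 0) (C₂ₙ[2,1,n] n (<⇒≤ 3<n))
  word-represents = Uniform⇒∈ {w = word n 0} (word-uniform n 0) , adj⇔alternate
    where
    G = C₂ₙ[2,1,n] n (<⇒≤ 3<n)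
    adj⇔alternate : ∀ x y → x ≢ y → Adj G x y ⇔ Alternate x y (word n 0)
    adj⇔alternate x y x≢y with <-cmp (toℕ x) (toℕ y)
    ... | tri< x<y _ _ = Adj⇔Alternate-< x<y
    ... | tri≈ _ x≡y _ = contradiction (toℕ-injective x≡y) x≢y
    ... | tri> _ _ y<x = mk⇔ (Alternate-sym {w = word n 0}) (Alternate-sym {w = word n 0})
      ⇔-∘ (Adj⇔Alternate-< y<x ⇔-∘ mk⇔ (Graph.sym G {x} {y}) (Graph.sym G {y} {x}))

-- Existence of the representation number, and the case n = 3

theorem29 : (∀ (n : ℕ) (3<n : 3 < n) →
    WordRepresentable (C₂ₙ[2,1,n] n (<⇒≤ 3<n))
    × RepresentationNumber≤ (C₂ₙ[2,1,n] n (<⇒≤ 3<n)) 3)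
    × (WordRepresentable (C₂ₙ[2,1,n] 3 ≤-refl)
    × IsRepresentationNumber (C₂ₙ[2,1,n] 3 ≤-refl) 1)
theorem29 = large , (allFin 6 , represents) , (allFin 6 , uniform , represents) , λ where
    -- A representing word contains the letter 0, so it cannot be 0-uniform.
    zero (w , uniform₀ , w-represents) → contradiction
      (uniform₀ Fin.zero) (>⇒≢ (filter-some (Fin.zero ≟_) (proj₁ w-represents Fin.zero)))
    (suc j) _ → s≤s z≤n
  where
  -- For n = 3 the jumps 1, 2, 3 are all the possible distances, so the graph is complete and
  -- listing each vertex once represents it.
  K₆ = C₂ₙ[2,1,n] 3 ≤-refl
  uniform : Uniform 1 (allFin 6)
  uniform = from-yes (all? (λ v → count v (allFin 6) ℕₚ.≟ 1))
  represents : Represents (allFin 6) K₆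
  represents = from-yes (represents? K₆ (circularDistance∈? _) (allFin 6))
  large : ∀ n (3<n : 3 < n) → WordRepresentable (C₂ₙ[2,1,n] n (<⇒≤ 3<n))
                            × RepresentationNumber≤ (C₂ₙ[2,1,n] n (<⇒≤ 3<n)) 3
  large n 3<n = (word n {{nz}} 0 , word-represents 3<n)
    -- The 3-uniform word bounds the search for the least k by 3.
    , least (representable? (C₂ₙ[2,1,n] n (<⇒≤ 3<n)) (circularDistance∈? _)) 3
        (word n {{nz}} 0 , word-uniform n {{nz}} 0 , word-represents 3<n)
    where nz = >-nonZero (≤-trans (s≤s z≤n) 3<n)
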